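{- For all integers $m\ge 1$ and $n\ge 2$, \[ \sum_{i=0}^{\min\{m,\lfloor n/2\rfloor\}}\prod_{j=1}^i\frac{ -(m-j)\binom{n-2j}{2}}{m\binom{n}{2}-(m-j)\binom{n-2j}{2}} =m\prod_{j=1}^{m-1}\frac{mn-\binom{m+1}{2}+\binom{j}{2}}{d_j}, \] where $d_j=\frac{1}{j}\bigl(m\binom{n}{2}-(m-j)\binom{n-2j}{2}\bigr)$, and where on the right-hand side any numerator factor $mn-\binom{m+1}{2}+\binom{j}{2}$ or denominator factor $d_j$ that equals zero is ignored (i.e. replaced by $1$).
   Context: Empty products are equal to $1$. Here $\binom{x}{2}=x(x-1)/2$ for every integer $x$ (including negative $x$). (The left-hand side equals the probability that a uniformly random vertex ordering of the line graph of the $3$-uniform hypergraph $K^{(1,2)}_{m,n}$ — vertex set $V_1\cup V_2$ with $|V_1|=m$, $|V_2|=n$, edges all $3$-sets meeting $V_1$ in one vertex and $V_2$ in two — is successive; this interpretation is not needed for the identity.) -}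

module Defs where

open import Data.Nat as ℕ using (ℕ; zero; suc)
open import Data.Integer using (+_)
open import Data.Rational using (ℚ; 0ℚ; 1ℚ; ½; _+_; _*_; _-_; -_; _÷_; _/_; ≢-nonZero)
open import Data.Rational.Properties using (_≟_)
open import Relation.Nullary using (yes; no)

ℕ→ℚ : ℕ → ℚ
ℕ→ℚ n = + n / 1

choose2 : ℚ → ℚ
choose2 x = x * (x - 1ℚ) * ½

_÷₀_ : ℚ → ℚ → ℚ
p ÷₀ q with q ≟ 0ℚ
... | yes _ = 0ℚ
... | no q≢0 = _÷_ p q {{≢-nonZero q≢0}}

ign : ℚ → ℚ
ign q with q ≟ 0ℚ
... | yes _ = 1ℚ
... | no _ = q

prod : ℕ → (ℕ → ℚ) → ℚ
prod zero f = 1ℚ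
prod (suc k) f = prod k f * f (suc k)

sum0 : ℕ → (ℕ → ℚ) → ℚ
sum0 zero f = f zero
sum0 (suc k) f = sum0 k f + f (suc k)

-- D m n j = m·C(n,2) − (m−j)·C(n−2j,2)   (computed in ℚ, so m−j, n−2j may be negative)
D : ℕ → ℕ → ℕ → ℚ
D m n j = ℕ→ℚ m * choose2 (ℕ→ℚ n) - (ℕ→ℚ m - ℕ→ℚ j) * choose2 (ℕ→ℚ n - ℕ→ℚ (2 ℕ.* j))

lhsFactor : ℕ → ℕ → ℕ → ℚ
lhsFactor m n j = (- ((ℕ→ℚ m - ℕ→ℚ j) * choose2 (ℕ→ℚ n - ℕ→ℚ (2 ℕ.* j)))) ÷₀ D m n j

LHS : ℕ → ℕ → ℚ
LHS m n = sum0 (ℕ._⊓_ m (n ℕ./ 2)) (λ i → prod i (lhsFactor m n))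

dj : ℕ → ℕ → ℕ → ℚ
dj m n j = D m n j ÷₀ ℕ→ℚ j

numj : ℕ → ℕ → ℕ → ℚ
numj m n j = ℕ→ℚ (m ℕ.* n) - choose2 (ℕ→ℚ (suc m)) + choose2 (ℕ→ℚ j)

RHS : ℕ → ℕ → ℚ
RHS m n = ℕ→ℚ m * prod (m ℕ.∸ 1) (λ j → ign (numj m n j) ÷₀ ign (dj m n j))

{-# OPTIONS --safe #-}
module Submission where

-- Write m = M + 1, h(x) = c + C(x,2) with c = mn − C(m+1,2). Then dⱼ = h(m+n−2j) and the numerators
-- are h(j). Abel summation turns the left-hand side into m times the Saalschützian sum
-- Σᵢ (−1)ⁱ C(M,i) n(n−1)⋯(n−2i+1) / (2ⁱ d₁⋯dᵢ). Its cleared form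
--   Σᵢ (−1)ⁱ C(M,i) n(n−1)⋯(n−2i+1) 2⁻ⁱ ∏_{i<j≤M} h(m+n−2j) = ∏_{j≤M} h(j)
-- holds for every c and follows by telescoping from (M, n−1) to (M+1, n). When zero factors occur,
-- there is exactly one on each side and it sits beyond the last nonzero summand, so the derivative in c
-- of the cleared identity is the same identity with the zero factors left out.

open import Defs
open import Data.Nat as ℕ using (ℕ; zero; suc; _≤_; _<_; s≤s)
import Data.Nat.Properties as ℕₚ
import Data.Nat.DivMod as ℕ
import Data.Nat.Tactic.RingSolver as ℕTactic
open import Data.Integer as ℤ using (+_)
import Data.Integer.Properties as ℤₚ
open import Data.Rational using (ℚ; 0ℚ; 1ℚ; ½; _+_; _*_; _-_; -_; 1/_; ≢-nonZero; toℚᵘ)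
open import Data.Rational.Properties
import Data.Rational.Unnormalised as ℚᵘ
import Data.Rational.Unnormalised.Properties as ℚᵘ
open import Data.Rational.Solver using (module +-*-Solver)
open import Data.Product using (∃-syntax; _×_; _,_)
open import Data.Sum using (_⊎_; inj₁; inj₂; [_,_]′)
open import Data.Empty using (⊥; ⊥-elim)
open import Relation.Nullary using (yes; no; contradiction)
open import Relation.Binary.PropositionalEquality
open +-*-Solver

-- Arithmetic of the embedding of ℕ into ℚ.

ℕ→ℚ-toℚᵘ : ∀ a → toℚᵘ (ℕ→ℚ a) ℚᵘ.≃ ℚᵘ.mkℚᵘ (+ a) 0
ℕ→ℚ-toℚᵘ a = toℚᵘ-fromℚᵘ (ℚᵘ.mkℚᵘ (+ a) 0)

ℕ→ℚ-+ : ∀ a b → ℕ→ℚ (a ℕ.+ b) ≡ ℕ→ℚ a + ℕ→ℚ b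
ℕ→ℚ-+ a b = toℚᵘ-injective (begin-equality
  toℚᵘ (ℕ→ℚ (a ℕ.+ b))                     ≃⟨ ℕ→ℚ-toℚᵘ (a ℕ.+ b) ⟩
  ℚᵘ.mkℚᵘ (+ (a ℕ.+ b)) 0                  ≃⟨ ℚᵘ.*≡* (cong (ℤ._* + 1) (cong₂ ℤ._+_ (sym (ℤₚ.*-identityʳ (+ a))) (sym (ℤₚ.*-identityʳ (+ b))))) ⟩
  ℚᵘ.mkℚᵘ (+ a) 0 ℚᵘ.+ ℚᵘ.mkℚᵘ (+ b) 0     ≃⟨ ℚᵘ.+-cong (ℕ→ℚ-toℚᵘ a) (ℕ→ℚ-toℚᵘ b) ⟨
  toℚᵘ (ℕ→ℚ a) ℚᵘ.+ toℚᵘ (ℕ→ℚ b)           ≃⟨ toℚᵘ-homo-+ (ℕ→ℚ a) (ℕ→ℚ b) ⟨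
  toℚᵘ (ℕ→ℚ a + ℕ→ℚ b)                     ∎)
  where open ℚᵘ.≤-Reasoning

ℕ→ℚ-* : ∀ a b → ℕ→ℚ (a ℕ.* b) ≡ ℕ→ℚ a * ℕ→ℚ b
ℕ→ℚ-* a b = toℚᵘ-injective (begin-equality
  toℚᵘ (ℕ→ℚ (a ℕ.* b))                     ≃⟨ ℕ→ℚ-toℚᵘ (a ℕ.* b) ⟩
  ℚᵘ.mkℚᵘ (+ (a ℕ.* b)) 0                  ≃⟨ ℚᵘ.*≡* (cong (ℤ._* + 1) (ℤₚ.pos-* a b)) ⟩
  ℚᵘ.mkℚᵘ (+ a) 0 ℚᵘ.* ℚᵘ.mkℚᵘ (+ b) 0     ≃⟨ ℚᵘ.*-cong (ℕ→ℚ-toℚᵘ a) (ℕ→ℚ-toℚᵘ b) ⟨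
  toℚᵘ (ℕ→ℚ a) ℚᵘ.* toℚᵘ (ℕ→ℚ b)           ≃⟨ toℚᵘ-homo-* (ℕ→ℚ a) (ℕ→ℚ b) ⟨
  toℚᵘ (ℕ→ℚ a * ℕ→ℚ b)                     ∎)
  where open ℚᵘ.≤-Reasoning

ℕ→ℚ-injective : ∀ {a b} → ℕ→ℚ a ≡ ℕ→ℚ b → a ≡ b
ℕ→ℚ-injective {a} {b} e
  with ℚᵘ.≃-trans (ℚᵘ.≃-sym (ℕ→ℚ-toℚᵘ a)) (ℚᵘ.≃-trans (ℚᵘ.≃-reflexive (cong toℚᵘ e)) (ℕ→ℚ-toℚᵘ b))
... | ℚᵘ.*≡* eq = ℤₚ.+-injective (trans (sym (ℤₚ.*-identityʳ (+ a))) (trans eq (ℤₚ.*-identityʳ (+ b))))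

ℕ→ℚ-suc : ∀ a → ℕ→ℚ (suc a) ≡ ℕ→ℚ a + 1ℚ
ℕ→ℚ-suc a = trans (ℕ→ℚ-+ 1 a) (+-comm 1ℚ (ℕ→ℚ a))

ℕ→ℚ-suc≢0 : ∀ a → ℕ→ℚ (suc a) ≢ 0ℚ
ℕ→ℚ-suc≢0 a e with ℕ→ℚ-injective {suc a} {0} e
... | ()

recip : ℕ → ℚ
recip i = (1/ ℕ→ℚ (suc i)) {{≢-nonZero (ℕ→ℚ-suc≢0 i)}}

recip-inverse : ∀ i → (ℕ→ℚ i + 1ℚ) * recip i ≡ 1ℚ
recip-inverse i = trans (cong (_* recip i) (sym (ℕ→ℚ-suc i)))
  (*-inverseʳ (ℕ→ℚ (suc i)) {{≢-nonZero (ℕ→ℚ-suc≢0 i)}})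

-- Hypergeometric coefficients and their contiguous relation.

-- The coefficients (−M)ᵢ (−ν/2)ᵢ ((1−ν)/2)ᵢ 2ⁱ / i! of a terminating ₃F₂.
coef : ℚ → ℚ → ℕ → ℚ
coef M ν zero    = 1ℚ
coef M ν (suc i) = coef M ν i * (- ((M - ℕ→ℚ i) * choose2 (ν - (ℕ→ℚ i + ℕ→ℚ i)))) * recip i

ch : ∀ {k} → Polynomial k → Polynomial k
ch x = x :* (x :- con 1ℚ) :* con ½

-- C(M+1, i+1) = (M+1)/(i+1) · C(M, i), and the falling factorial of ν of length 2i+2 is that of ν-1
-- of length 2i with the outer factors ν and ν-2i-1 added.
coef-shift : ∀ M ν i → coef (M + 1ℚ) ν (suc i) ≡
  - (coef M (ν - 1ℚ) i * ((M + 1ℚ) * ν * (ν - (ℕ→ℚ i + ℕ→ℚ i) - 1ℚ) * ½ * recip i))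
coef-shift M ν zero = base M ν (recip 0)
  where
  base : ∀ M ν u → 1ℚ * (- ((M + 1ℚ - 0ℚ) * choose2 (ν - (0ℚ + 0ℚ)))) * u ≡
    - (1ℚ * ((M + 1ℚ) * ν * (ν - (0ℚ + 0ℚ) - 1ℚ) * ½ * u))
  base = solve 3 (λ M ν u → con 1ℚ :* (:- ((M :+ con 1ℚ :- con 0ℚ) :* ch (ν :- (con 0ℚ :+ con 0ℚ)))) :* u :=
    :- (con 1ℚ :* ((M :+ con 1ℚ) :* ν :* (ν :- (con 0ℚ :+ con 0ℚ) :- con 1ℚ) :* con ½ :* u))) refl
coef-shift M ν (suc i) =
  trans (cong (λ z → z * (- ((M + 1ℚ - ℕ→ℚ (suc i)) * choose2 (ν - (ℕ→ℚ (suc i) + ℕ→ℚ (suc i))))) * recip (suc i)) (coef-shift M ν i))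
        (step M ν (ℕ→ℚ i) (coef M (ν - 1ℚ) i) (recip i) (recip (suc i)) (ℕ→ℚ-suc i))
  where
  step : ∀ M ν i k u w {i'} → i' ≡ i + 1ℚ →
    - (k * ((M + 1ℚ) * ν * (ν - (i + i) - 1ℚ) * ½ * u)) * (- ((M + 1ℚ - i') * choose2 (ν - (i' + i')))) * w ≡
    - (k * (- ((M - i) * choose2 (ν - 1ℚ - (i + i)))) * u * ((M + 1ℚ) * ν * (ν - (i' + i') - 1ℚ) * ½ * w))
  step M ν i k u w refl = solve 6 (λ M ν i k u w →
    :- (k :* ((M :+ con 1ℚ) :* ν :* (ν :- (i :+ i) :- con 1ℚ) :* con ½ :* u)) :* (:- ((M :+ con 1ℚ :- (i :+ con 1ℚ)) :* ch (ν :- (i :+ con 1ℚ :+ (i :+ con 1ℚ))))) :* w :=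
    :- (k :* (:- ((M :- i) :* ch (ν :- con 1ℚ :- (i :+ i)))) :* u :* ((M :+ con 1ℚ) :* ν :* (ν :- (i :+ con 1ℚ :+ (i :+ con 1ℚ)) :- con 1ℚ) :* con ½ :* w))) refl M ν i k u w

-- The bracket is h(M+1) minus `node c M (ν - 1) i`, with c cancelled; this is what telescopes in
-- `S-shift`. By `coef-shift` every term is a multiple of `coef M (ν - 1) i`, which leaves a
-- polynomial identity.
coef-pascal : ∀ M ν i → coef (M + 1ℚ) ν (suc i) ≡
  coef M (ν - 1ℚ) (suc i) + coef M (ν - 1ℚ) i * (choose2 (M + 1ℚ) - choose2 (M + ν - (ℕ→ℚ i + ℕ→ℚ i)))
coef-pascal M ν i = trans (coef-shift M ν i)
  (trans (identity M ν (ℕ→ℚ i) (coef M (ν - 1ℚ) i) (recip i))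
         (cong (λ z → coef M (ν - 1ℚ) (suc i) + coef M (ν - 1ℚ) i * z)
           (trans (cong (_* X) (recip-inverse i)) (*-identityˡ X))))
  where
  X : ℚ
  X = choose2 (M + 1ℚ) - choose2 (M + ν - (ℕ→ℚ i + ℕ→ℚ i))
  identity : ∀ M ν i k u → - (k * ((M + 1ℚ) * ν * (ν - (i + i) - 1ℚ) * ½ * u)) ≡
    k * (- ((M - i) * choose2 (ν - 1ℚ - (i + i)))) * u +
    k * ((i + 1ℚ) * u * (choose2 (M + 1ℚ) - choose2 (M + ν - (i + i))))
  identity = solve 5 (λ M ν i k u →
    :- (k :* ((M :+ con 1ℚ) :* ν :* (ν :- (i :+ i) :- con 1ℚ) :* con ½ :* u)) :=
    k :* (:- ((M :- i) :* ch (ν :- con 1ℚ :- (i :+ i)))) :* u :+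
    k :* ((i :+ con 1ℚ) :* u :* (ch (M :+ con 1ℚ) :- ch (M :+ ν :- (i :+ i))))) refl

-- Telescoping evaluation of the cleared sum and of its derivative in c.

-- Horner scheme for the sum over l ≤ i of k_l ∏_{l<j≤i} u_j. It is free of division, so nodes may
-- be zero.
horner : (ℕ → ℚ) → (ℕ → ℚ) → ℕ → ℚ
horner u k zero    = k zero
horner u k (suc i) = horner u k i * u (suc i) + k (suc i)

-- The derivative of horner when every node uⱼ has derivative 1.
horner′ : (ℕ → ℚ) → (ℕ → ℚ) → ℕ → ℚ
horner′ u k zero    = 0ℚ
horner′ u k (suc i) = horner′ u k i * u (suc i) + horner u k i

prod′ : (ℕ → ℚ) → ℕ → ℚ
prod′ u zero    = 0ℚ
prod′ u (suc i) = prod′ u i * u (suc i) + prod i u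

shiftedChoose2 : ℚ → ℕ → ℚ
shiftedChoose2 c j = c + choose2 (ℕ→ℚ j)

-- At M = m - 1 and ν = n this is h(m+n-2j).
node : ℚ → ℚ → ℚ → ℕ → ℚ
node c M ν j = c + choose2 (M + 1ℚ + ν - (ℕ→ℚ j + ℕ→ℚ j))

node-suc : ∀ c M ν j → node c (M + 1ℚ) ν (suc j) ≡ node c M (ν - 1ℚ) j
node-suc c M ν j = cong (λ z → c + choose2 z)
  (trans (cong (λ z → M + 1ℚ + 1ℚ + ν - (z + z)) (ℕ→ℚ-suc j))
         (solve 3 (λ M ν j → M :+ con 1ℚ :+ con 1ℚ :+ ν :- (j :+ con 1ℚ :+ (j :+ con 1ℚ)) :=
                             M :+ con 1ℚ :+ (ν :- con 1ℚ) :- (j :+ j)) refl M ν (ℕ→ℚ j)))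

module Saalschütz (c : ℚ) where

  S S′ : ℚ → ℚ → ℕ → ℚ
  S M ν = horner (node c M ν) (coef M ν)
  S′ M ν = horner′ (node c M ν) (coef M ν)

  -- Induction on i, with the nodes matched by `node-suc`. The previous remainder k, multiplied by
  -- its node u, cancels the -ku of `coef-pascal`; what stays is k·h(M+1), the next term of
  -- h(M+1)·S.
  S-shift : ∀ M ν i → S (M + 1ℚ) ν (suc i) ≡
    (c + choose2 (M + 1ℚ)) * S M (ν - 1ℚ) i + coef M (ν - 1ℚ) (suc i)
  S-shift M ν zero =
    trans (cong₂ (λ z w → 1ℚ * z + w) (node-suc c M ν 0) (coef-pascal M ν 0))
          (identity c M ν (coef M (ν - 1ℚ) 1))
    where
    identity : ∀ c M ν k →
      1ℚ * (c + choose2 (M + 1ℚ + (ν - 1ℚ) - (0ℚ + 0ℚ))) + (k + 1ℚ * (choose2 (M + 1ℚ) - choose2 (M + ν - (0ℚ + 0ℚ)))) ≡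
      (c + choose2 (M + 1ℚ)) * 1ℚ + k
    identity = solve 4 (λ c M ν k →
      con 1ℚ :* (c :+ ch (M :+ con 1ℚ :+ (ν :- con 1ℚ) :- (con 0ℚ :+ con 0ℚ))) :+ (k :+ con 1ℚ :* (ch (M :+ con 1ℚ) :- ch (M :+ ν :- (con 0ℚ :+ con 0ℚ)))) :=
      (c :+ ch (M :+ con 1ℚ)) :* con 1ℚ :+ k) refl
  S-shift M ν (suc i) =
    trans (cong₂ (λ z w → z * node c (M + 1ℚ) ν (suc (suc i)) + w) (S-shift M ν i) (coef-pascal M ν (suc i)))
    (trans (cong (λ z → ((c + choose2 (M + 1ℚ)) * S M (ν - 1ℚ) i + coef M (ν - 1ℚ) (suc i)) * z +
                        (coef M (ν - 1ℚ) (suc (suc i)) + coef M (ν - 1ℚ) (suc i) * (choose2 (M + 1ℚ) - choose2 (M + ν - (ℕ→ℚ (suc i) + ℕ→ℚ (suc i))))))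
                 (node-suc c M ν (suc i)))
           (identity c M ν (ℕ→ℚ (suc i)) (S M (ν - 1ℚ) i) (coef M (ν - 1ℚ) (suc i)) (coef M (ν - 1ℚ) (suc (suc i)))))
    where
    identity : ∀ c M ν i s k l →
      ((c + choose2 (M + 1ℚ)) * s + k) * (c + choose2 (M + 1ℚ + (ν - 1ℚ) - (i + i))) + (l + k * (choose2 (M + 1ℚ) - choose2 (M + ν - (i + i)))) ≡
      (c + choose2 (M + 1ℚ)) * (s * (c + choose2 (M + 1ℚ + (ν - 1ℚ) - (i + i))) + k) + l
    identity = solve 7 (λ c M ν i s k l →
      ((c :+ ch (M :+ con 1ℚ)) :* s :+ k) :* (c :+ ch (M :+ con 1ℚ :+ (ν :- con 1ℚ) :- (i :+ i))) :+ (l :+ k :* (ch (M :+ con 1ℚ) :- ch (M :+ ν :- (i :+ i)))) :=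
      (c :+ ch (M :+ con 1ℚ)) :* (s :* (c :+ ch (M :+ con 1ℚ :+ (ν :- con 1ℚ) :- (i :+ i))) :+ k) :+ l) refl

  -- The derivative of `S-shift` in c: the coefficients do not involve c, so the remainder drops
  -- out.
  S′-shift : ∀ M ν i → S′ (M + 1ℚ) ν (suc i) ≡
    (c + choose2 (M + 1ℚ)) * S′ M (ν - 1ℚ) i + S M (ν - 1ℚ) i
  S′-shift M ν zero = solve 2 (λ x y → con 0ℚ :* x :+ con 1ℚ := y :* con 0ℚ :+ con 1ℚ) refl (node c (M + 1ℚ) ν 1) (c + choose2 (M + 1ℚ))
  S′-shift M ν (suc i) =
    trans (cong₂ (λ z w → z * node c (M + 1ℚ) ν (suc (suc i)) + w) (S′-shift M ν i) (S-shift M ν i))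
    (trans (cong (λ z → ((c + choose2 (M + 1ℚ)) * S′ M (ν - 1ℚ) i + S M (ν - 1ℚ) i) * z +
                        ((c + choose2 (M + 1ℚ)) * S M (ν - 1ℚ) i + coef M (ν - 1ℚ) (suc i)))
                 (node-suc c M ν (suc i)))
           (solve 5 (λ h s′ s u k → (h :* s′ :+ s) :* u :+ (h :* s :+ k) := h :* (s′ :* u :+ s) :+ (s :* u :+ k)) refl
              (c + choose2 (M + 1ℚ)) (S′ M (ν - 1ℚ) i) (S M (ν - 1ℚ) i) (node c M (ν - 1ℚ) (suc i)) (coef M (ν - 1ℚ) (suc i))))

  coef-vanishes : ∀ M ν → coef (ℕ→ℚ M) ν (suc M) ≡ 0ℚ
  coef-vanishes M ν = solve 4 (λ M k z u → k :* (:- ((M :- M) :* z)) :* u := con 0ℚ) refl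
    (ℕ→ℚ M) (coef (ℕ→ℚ M) ν M) (choose2 (ν - (ℕ→ℚ M + ℕ→ℚ M))) (recip M)

  -- At i = M the remainder in `S-shift` contains C(M, M+1) = 0, so each step contributes exactly
  -- the factor h(M+1). The step lowers ν by 1, hence the induction is over all ν.
  S-total : ∀ M ν → S (ℕ→ℚ M) ν M ≡ prod M (shiftedChoose2 c)
  S-total zero ν = refl
  S-total (suc M) ν = begin
    S (ℕ→ℚ (suc M)) ν (suc M)
      ≡⟨ cong (λ z → S z ν (suc M)) (ℕ→ℚ-suc M) ⟩
    S (ℕ→ℚ M + 1ℚ) ν (suc M)
      ≡⟨ S-shift (ℕ→ℚ M) ν M ⟩
    (c + choose2 (ℕ→ℚ M + 1ℚ)) * S (ℕ→ℚ M) (ν - 1ℚ) M + coef (ℕ→ℚ M) (ν - 1ℚ) (suc M)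
      ≡⟨ cong₂ _+_ (cong₂ (λ z w → (c + choose2 z) * w) (sym (ℕ→ℚ-suc M)) (S-total M (ν - 1ℚ))) (coef-vanishes M (ν - 1ℚ)) ⟩
    shiftedChoose2 c (suc M) * prod M (shiftedChoose2 c) + 0ℚ
      ≡⟨ +-identityʳ _ ⟩
    shiftedChoose2 c (suc M) * prod M (shiftedChoose2 c)
      ≡⟨ *-comm _ (prod M (shiftedChoose2 c)) ⟩
    prod (suc M) (shiftedChoose2 c) ∎
    where open ≡-Reasoning

  S′-total : ∀ M ν → S′ (ℕ→ℚ M) ν M ≡ prod′ (shiftedChoose2 c) M
  S′-total zero ν = refl
  S′-total (suc M) ν = begin
    S′ (ℕ→ℚ (suc M)) ν (suc M)
      ≡⟨ cong (λ z → S′ z ν (suc M)) (ℕ→ℚ-suc M) ⟩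
    S′ (ℕ→ℚ M + 1ℚ) ν (suc M)
      ≡⟨ S′-shift (ℕ→ℚ M) ν M ⟩
    (c + choose2 (ℕ→ℚ M + 1ℚ)) * S′ (ℕ→ℚ M) (ν - 1ℚ) M + S (ℕ→ℚ M) (ν - 1ℚ) M
      ≡⟨ cong₂ _+_ (cong₂ (λ z w → (c + choose2 z) * w) (sym (ℕ→ℚ-suc M)) (S′-total M (ν - 1ℚ))) (S-total M (ν - 1ℚ)) ⟩
    shiftedChoose2 c (suc M) * prod′ (shiftedChoose2 c) M + prod M (shiftedChoose2 c)
      ≡⟨ cong (_+ prod M (shiftedChoose2 c)) (*-comm _ (prod′ (shiftedChoose2 c) M)) ⟩
    prod′ (shiftedChoose2 c) (suc M) ∎
    where open ≡-Reasoning

-- Products, division and the convention of ignored zeros.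

*-≢0 : ∀ {p q} → p ≢ 0ℚ → q ≢ 0ℚ → p * q ≢ 0ℚ
*-≢0 {p} {q} p≢0 q≢0 pq≡0 = q≢0 (begin
  q                 ≡⟨ *-identityˡ q ⟨
  1ℚ * q            ≡⟨ cong (_* q) (*-inverseˡ p) ⟨
  1/ p * p * q      ≡⟨ *-assoc (1/ p) p q ⟩
  1/ p * (p * q)    ≡⟨ cong (1/ p *_) pq≡0 ⟩
  1/ p * 0ℚ         ≡⟨ *-zeroʳ (1/ p) ⟩
  0ℚ                ∎)
  where
  open ≡-Reasoning
  instance _ = ≢-nonZero p≢0

*-cancelʳ-≢0 : ∀ {p q} r → r ≢ 0ℚ → p * r ≡ q * r → p ≡ q
*-cancelʳ-≢0 {p} {q} r r≢0 e = begin
  p                 ≡⟨ undo p ⟨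
  p * r * 1/ r      ≡⟨ cong (_* 1/ r) e ⟩
  q * r * 1/ r      ≡⟨ undo q ⟩
  q                 ∎
  where
  open ≡-Reasoning
  instance _ = ≢-nonZero r≢0
  undo : ∀ x → x * r * 1/ r ≡ x
  undo x = trans (*-assoc x r (1/ r)) (trans (cong (x *_) (*-inverseʳ r)) (*-identityʳ x))

÷₀-* : ∀ p {q} → q ≢ 0ℚ → (p ÷₀ q) * q ≡ p
÷₀-* p {q} q≢0 with q ≟ 0ℚ
... | yes q≡0 = contradiction q≡0 q≢0
... | no  q≢0′ = trans (*-assoc p _ q) (trans (cong (p *_) (*-inverseˡ q {{≢-nonZero q≢0′}})) (*-identityʳ p))

0÷₀ : ∀ q → 0ℚ ÷₀ q ≡ 0ℚ
0÷₀ q with q ≟ 0ℚ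
... | yes _ = refl
... | no  q≢0 = *-zeroˡ ((1/ q) {{≢-nonZero q≢0}})

ign-≢0 : ∀ q → ign q ≢ 0ℚ
ign-≢0 q with q ≟ 0ℚ
... | yes _   = λ ()
... | no  q≢0 = q≢0

ign-id : ∀ {q} → q ≢ 0ℚ → ign q ≡ q
ign-id {q} q≢0 with q ≟ 0ℚ
... | yes q≡0 = contradiction q≡0 q≢0
... | no  _   = refl

prod-cong : ∀ i {f g : ℕ → ℚ} → (∀ j → j < i → f (suc j) ≡ g (suc j)) → prod i f ≡ prod i g
prod-cong zero    e = refl
prod-cong (suc i) e = cong₂ _*_ (prod-cong i (λ j j<i → e j (ℕₚ.m<n⇒m<1+n j<i))) (e i ℕₚ.≤-refl)

prod-≢0 : ∀ i {f} → (∀ j → f j ≢ 0ℚ) → prod i f ≢ 0ℚ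
prod-≢0 zero    f≢0 = λ ()
prod-≢0 (suc i) f≢0 = *-≢0 (prod-≢0 i f≢0) (f≢0 (suc i))

prod-÷₀ : ∀ i f {g} → (∀ j → g j ≢ 0ℚ) → prod i (λ j → f j ÷₀ g j) * prod i g ≡ prod i f
prod-÷₀ zero    f g≢0 = refl
prod-÷₀ (suc i) f {g} g≢0 = begin
  prod i q * q (suc i) * (prod i g * g (suc i))
    ≡⟨ solve 4 (λ a b c d → a :* b :* (c :* d) := a :* c :* (b :* d)) refl (prod i q) (q (suc i)) (prod i g) (g (suc i)) ⟩
  prod i q * prod i g * (q (suc i) * g (suc i))
    ≡⟨ cong₂ _*_ (prod-÷₀ i f g≢0) (÷₀-* (f (suc i)) (g≢0 (suc i))) ⟩
  prod i f * f (suc i) ∎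
  where
  open ≡-Reasoning
  q : ℕ → ℚ
  q j = f j ÷₀ g j

-- Counting zero factors over the dual numbers.

-- Over the dual numbers, (x , x′) is a multiple of the product of the (uⱼ , 1),
-- and y is the same multiple of the product of the nonzero uⱼ.
data ZeroFactors (u : ℕ → ℚ) (i : ℕ) (x x′ y : ℚ) : Set where
  none : (∀ j → j < i → u (suc j) ≢ 0ℚ) → x ≡ y → ZeroFactors u i x x′ y
  one  : ∀ j → j < i → u (suc j) ≡ 0ℚ → x ≡ 0ℚ → x′ ≡ y → ZeroFactors u i x x′ y
  many : ∀ j k → j < k → k < i → u (suc j) ≡ 0ℚ → u (suc k) ≡ 0ℚ → x ≡ 0ℚ → x′ ≡ 0ℚ → ZeroFactors u i x x′ y

-- (x + x′ε)(u + ε) = xu + (x′u + x)ε. The first zero factor moves x into the derivative, a second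
-- one kills both parts, and a nonzero factor rescales the part that survives.
ZeroFactors-suc : ∀ {u i x x′ y} → ZeroFactors u i x x′ y →
  ZeroFactors u (suc i) (x * u (suc i)) (x′ * u (suc i) + x) (y * ign (u (suc i)))
ZeroFactors-suc {u} {i} {x} {x′} {y} z with u (suc i) ≟ 0ℚ
ZeroFactors-suc {u} {i} {x} {x′} {y} (none ≢0 x≡y) | yes e =
  one i ℕₚ.≤-refl e (trans (cong (x *_) e) (*-zeroʳ x))
    (trans (cong (λ v → x′ * v + x) e) (trans (solve 2 (λ a b → a :* con 0ℚ :+ b := b :* con 1ℚ) refl x′ x) (cong (_* 1ℚ) x≡y)))
ZeroFactors-suc {u} {i} {x} {x′} {y} (one j j<i e′ x≡0 x′≡y) | yes e =
  many j i j<i ℕₚ.≤-refl e′ e (trans (cong (x *_) e) (*-zeroʳ x))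
    (trans (cong₂ (λ v w → x′ * v + w) e x≡0) (trans (+-identityʳ _) (*-zeroʳ x′)))
ZeroFactors-suc {u} {i} {x} {x′} {y} (many j k j<k k<i e₁ e₂ x≡0 x′≡0) | yes e =
  many j k j<k (ℕₚ.m<n⇒m<1+n k<i) e₁ e₂ (trans (cong (x *_) e) (*-zeroʳ x))
    (trans (cong₂ (λ v w → x′ * v + w) e x≡0) (trans (+-identityʳ _) (*-zeroʳ x′)))
ZeroFactors-suc {u} {i} {x} {x′} {y} (none ≢0 x≡y) | no ne = none ≢0′ (cong (_* u (suc i)) x≡y)
  where
  ≢0′ : ∀ j → j < suc i → u (suc j) ≢ 0ℚ
  ≢0′ j j<1+i with ℕₚ.m≤n⇒m<n∨m≡n (ℕₚ.≤-pred j<1+i)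
  ... | inj₁ j<i  = ≢0 j j<i
  ... | inj₂ refl = ne
ZeroFactors-suc {u} {i} {x} {x′} {y} (one j j<i e x≡0 x′≡y) | no _ =
  one j (ℕₚ.m<n⇒m<1+n j<i) e (trans (cong (_* u (suc i)) x≡0) (*-zeroˡ (u (suc i))))
    (trans (cong₂ (λ v w → v * u (suc i) + w) x′≡y x≡0) (+-identityʳ _))
ZeroFactors-suc {u} {i} {x} {x′} {y} (many j k j<k k<i e₁ e₂ x≡0 x′≡0) | no _ =
  many j k j<k (ℕₚ.m<n⇒m<1+n k<i) e₁ e₂ (trans (cong (_* u (suc i)) x≡0) (*-zeroˡ (u (suc i))))
    (trans (cong₂ (λ v w → v * u (suc i) + w) x′≡0 x≡0) (trans (+-identityʳ _) (*-zeroˡ (u (suc i)))))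

prod-ZeroFactors : ∀ u i → ZeroFactors u i (prod i u) (prod′ u i) (prod i (λ j → ign (u j)))
prod-ZeroFactors u zero    = none (λ _ ()) refl
prod-ZeroFactors u (suc i) = ZeroFactors-suc (prod-ZeroFactors u i)

y+y≤1+r+r⇒y≤r : ∀ y r → y ℕ.+ y ≤ suc (r ℕ.+ r) → y ≤ r
y+y≤1+r+r⇒y≤r y r le with y ℕ.≤? r
... | yes y≤r = y≤r
... | no  y≰r = contradiction (ℕₚ.≤-trans (ℕₚ.+-mono-≤ (ℕₚ.≰⇒> y≰r) (ℕₚ.≰⇒> y≰r)) le)
  (ℕₚ.<⇒≱ (s≤s (ℕₚ.≤-reflexive (sym (ℕₚ.+-suc r r)))))

parity : ∀ x → ∃[ y ] (x ≡ y ℕ.+ y ⊎ x ≡ suc (y ℕ.+ y))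
parity zero = 0 , inj₁ refl
parity (suc x) with parity x
... | y , inj₁ e = y , inj₂ (cong suc e)
... | y , inj₂ e = suc y , inj₁ (cong suc (trans e (sym (ℕₚ.+-suc y y))))

-- Nonvanishing is certified below by exhibiting twice the quantity as a natural number that is
-- visibly a successor.
half-ℕ→ℚ-≢0 : ∀ {x} a .{{_ : ℕ.NonZero a}} → x ≡ ℕ→ℚ a * ½ → x ≢ 0ℚ
half-ℕ→ℚ-≢0 (suc a) e x≡0 = *-≢0 (ℕ→ℚ-suc≢0 a) (λ ()) (trans (sym e) x≡0)

-- The factors h(j) and h(m+n-2j) and their zeros.

module Factors (M n : ℕ) where

  𝑚 ν c : ℚ
  𝑚 = ℕ→ℚ M
  ν = ℕ→ℚ n
  c = ℕ→ℚ (suc M ℕ.* n) - choose2 (ℕ→ℚ (suc (suc M)))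

  h N : ℕ → ℚ
  h = node c 𝑚 ν
  N = shiftedChoose2 c

  c-expand : c ≡ (𝑚 + 1ℚ) * ν - choose2 (𝑚 + 1ℚ + 1ℚ)
  c-expand = cong₂ (λ x y → x - choose2 y)
    (trans (ℕ→ℚ-* (suc M) n) (cong (_* ν) (ℕ→ℚ-suc M)))
    (trans (ℕ→ℚ-suc (suc M)) (cong (_+ 1ℚ) (ℕ→ℚ-suc M)))

  a : ℕ → ℚ
  a j = (𝑚 + 1ℚ - ℕ→ℚ j) * choose2 (ν - (ℕ→ℚ j + ℕ→ℚ j))

  ℕ→ℚ-2* : ∀ j → ℕ→ℚ (2 ℕ.* j) ≡ ℕ→ℚ j + ℕ→ℚ j
  ℕ→ℚ-2* j = trans (cong (λ z → ℕ→ℚ (j ℕ.+ z)) (ℕₚ.+-identityʳ j)) (ℕ→ℚ-+ j j)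

  a-def : ∀ j → (ℕ→ℚ (suc M) - ℕ→ℚ j) * choose2 (ν - ℕ→ℚ (2 ℕ.* j)) ≡ a j
  a-def j = cong₂ (λ x y → (x - ℕ→ℚ j) * choose2 (ν - y)) (ℕ→ℚ-suc M) (ℕ→ℚ-2* j)

  D-a : ∀ j → D (suc M) n j ≡ (𝑚 + 1ℚ) * choose2 ν - a j
  D-a j = cong₂ (λ x y → x * choose2 ν - y) (ℕ→ℚ-suc M) (a-def j)

  -- In j the left side is a cubic that vanishes at 0; its quotient by j is h(m+n-2j) for exactly
  -- this c.
  D-factor : ∀ j → (𝑚 + 1ℚ) * choose2 ν - a j ≡ ℕ→ℚ j * h j
  D-factor j = trans (identity 𝑚 ν (ℕ→ℚ j))
    (cong (λ z → ℕ→ℚ j * (z + choose2 (𝑚 + 1ℚ + ν - (ℕ→ℚ j + ℕ→ℚ j)))) (sym c-expand))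
    where
    identity : ∀ m n j → (m + 1ℚ) * choose2 n - (m + 1ℚ - j) * choose2 (n - (j + j)) ≡
      j * ((m + 1ℚ) * n - choose2 (m + 1ℚ + 1ℚ) + choose2 (m + 1ℚ + n - (j + j)))
    identity = solve 3 (λ m n j → (m :+ con 1ℚ) :* ch n :- (m :+ con 1ℚ :- j) :* ch (n :- (j :+ j)) :=
      j :* ((m :+ con 1ℚ) :* n :- ch (m :+ con 1ℚ :+ con 1ℚ) :+ ch (m :+ con 1ℚ :+ n :- (j :+ j)))) refl

  D-h : ∀ j → D (suc M) n j ≡ ℕ→ℚ j * h j
  D-h j = trans (D-a j) (D-factor j)

  dj-h : ∀ j → dj (suc M) n (suc j) ≡ h (suc j)
  dj-h j = *-cancelʳ-≢0 (ℕ→ℚ (suc j)) (ℕ→ℚ-suc≢0 j)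
    (trans (÷₀-* (D (suc M) n (suc j)) (ℕ→ℚ-suc≢0 j)) (trans (D-h (suc j)) (*-comm (ℕ→ℚ (suc j)) (h (suc j)))))

  -- The argument of h is m + r, and twice the value is 2m(2j+1) + r(r+4m-1) > 0.
  h-≢0 : ∀ j r → n ≡ suc j ℕ.+ suc j ℕ.+ r → h (suc j) ≢ 0ℚ
  h-≢0 j r n≡ = half-ℕ→ℚ-≢0 E (begin
    c + choose2 (𝑚 + 1ℚ + ν - (ℕ→ℚ (suc j) + ℕ→ℚ (suc j)))
      ≡⟨ cong (_+ choose2 (𝑚 + 1ℚ + ν - (ℕ→ℚ (suc j) + ℕ→ℚ (suc j)))) c-expand ⟩
    (𝑚 + 1ℚ) * ν - choose2 (𝑚 + 1ℚ + 1ℚ) + choose2 (𝑚 + 1ℚ + ν - (ℕ→ℚ (suc j) + ℕ→ℚ (suc j)))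
      ≡⟨ cong₂ (λ z w → (𝑚 + 1ℚ) * z - choose2 (𝑚 + 1ℚ + 1ℚ) + choose2 (𝑚 + 1ℚ + z - (w + w))) ν≡ (ℕ→ℚ-suc j) ⟩
    _ ≡⟨ identity 𝑚 (ℕ→ℚ j) (ℕ→ℚ r) ⟩
    _ ≡⟨ cong (_* ½) E≡ ⟨
    ℕ→ℚ E * ½ ∎)
    where
    open ≡-Reasoning
    E : ℕ
    E = (suc M ℕ.+ suc M) ℕ.* suc (j ℕ.+ j) ℕ.+ r ℕ.* (r ℕ.+ (M ℕ.+ M ℕ.+ (M ℕ.+ M) ℕ.+ 3))
    ν≡ : ν ≡ ℕ→ℚ j + 1ℚ + (ℕ→ℚ j + 1ℚ) + ℕ→ℚ r
    ν≡ = trans (cong ℕ→ℚ n≡) (trans (ℕ→ℚ-+ (suc j ℕ.+ suc j) r)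
      (cong (_+ ℕ→ℚ r) (trans (ℕ→ℚ-+ (suc j) (suc j)) (cong₂ _+_ (ℕ→ℚ-suc j) (ℕ→ℚ-suc j)))))
    E≡ : ℕ→ℚ E ≡ (𝑚 + 1ℚ + (𝑚 + 1ℚ)) * (ℕ→ℚ j + ℕ→ℚ j + 1ℚ) + ℕ→ℚ r * (ℕ→ℚ r + (𝑚 + 𝑚 + (𝑚 + 𝑚) + ℕ→ℚ 3))
    E≡ = trans (ℕ→ℚ-+ ((suc M ℕ.+ suc M) ℕ.* suc (j ℕ.+ j)) _) (cong₂ _+_
      (trans (ℕ→ℚ-* (suc M ℕ.+ suc M) (suc (j ℕ.+ j)))
        (cong₂ _*_ (trans (ℕ→ℚ-+ (suc M) (suc M)) (cong₂ _+_ (ℕ→ℚ-suc M) (ℕ→ℚ-suc M)))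
                   (trans (ℕ→ℚ-suc (j ℕ.+ j)) (cong (_+ 1ℚ) (ℕ→ℚ-+ j j)))))
      (trans (ℕ→ℚ-* r (r ℕ.+ (M ℕ.+ M ℕ.+ (M ℕ.+ M) ℕ.+ 3))) (cong (ℕ→ℚ r *_) (trans (ℕ→ℚ-+ r _) (cong (λ z → ℕ→ℚ r + z)
        (trans (ℕ→ℚ-+ (M ℕ.+ M ℕ.+ (M ℕ.+ M)) 3) (cong (_+ ℕ→ℚ 3) (trans (ℕ→ℚ-+ (M ℕ.+ M) (M ℕ.+ M)) (cong₂ _+_ (ℕ→ℚ-+ M M) (ℕ→ℚ-+ M M))))))))))
    identity : ∀ m j r → (m + 1ℚ) * (j + 1ℚ + (j + 1ℚ) + r) - choose2 (m + 1ℚ + 1ℚ) +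
        choose2 (m + 1ℚ + (j + 1ℚ + (j + 1ℚ) + r) - (j + 1ℚ + (j + 1ℚ))) ≡
      ((m + 1ℚ + (m + 1ℚ)) * (j + j + 1ℚ) + r * (r + (m + m + (m + m) + ℕ→ℚ 3))) * ½
    identity = solve 3 (λ m j r → (m :+ con 1ℚ) :* (j :+ con 1ℚ :+ (j :+ con 1ℚ) :+ r) :- ch (m :+ con 1ℚ :+ con 1ℚ) :+
        ch (m :+ con 1ℚ :+ (j :+ con 1ℚ :+ (j :+ con 1ℚ) :+ r) :- (j :+ con 1ℚ :+ (j :+ con 1ℚ))) :=
      ((m :+ con 1ℚ :+ (m :+ con 1ℚ)) :* (j :+ j :+ con 1ℚ) :+ r :* (r :+ (m :+ m :+ (m :+ m) :+ con (ℕ→ℚ 3)))) :* con ½) refl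

  -- C(x,2) increases strictly on x ≥ 1: for k = j + 1 + r the two values differ by (r+1)(2j+r+2)/2.
  N-zero-unique : ∀ j k → j < k → N (suc j) ≡ 0ℚ → N (suc k) ≡ 0ℚ → ⊥
  N-zero-unique j k j<k Nj≡0 Nk≡0 with ℕₚ.m≤n⇒∃[o]m+o≡n j<k
  ... | r , refl = half-ℕ→ℚ-≢0 (suc r ℕ.* suc (suc (j ℕ.+ j ℕ.+ r))) (begin
    N (suc (suc (j ℕ.+ r))) - N (suc j)
      ≡⟨ cong₂ (λ x y → c + choose2 x - (c + choose2 y)) (trans (ℕ→ℚ-suc (suc (j ℕ.+ r))) (cong (_+ 1ℚ) (trans (ℕ→ℚ-suc (j ℕ.+ r)) (cong (_+ 1ℚ) (ℕ→ℚ-+ j r))))) (ℕ→ℚ-suc j) ⟩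
    _ ≡⟨ identity c (ℕ→ℚ j) (ℕ→ℚ r) ⟩
    _ ≡⟨ cong (_* ½) E≡ ⟨
    ℕ→ℚ (suc r ℕ.* suc (suc (j ℕ.+ j ℕ.+ r))) * ½ ∎) (cong₂ _-_ Nk≡0 Nj≡0)
    where
    open ≡-Reasoning
    E≡ : ℕ→ℚ (suc r ℕ.* suc (suc (j ℕ.+ j ℕ.+ r))) ≡ (ℕ→ℚ r + 1ℚ) * (ℕ→ℚ j + ℕ→ℚ j + ℕ→ℚ r + 1ℚ + 1ℚ)
    E≡ = trans (ℕ→ℚ-* (suc r) (suc (suc (j ℕ.+ j ℕ.+ r)))) (cong₂ _*_ (ℕ→ℚ-suc r)
      (trans (ℕ→ℚ-suc (suc (j ℕ.+ j ℕ.+ r))) (cong (_+ 1ℚ) (trans (ℕ→ℚ-suc (j ℕ.+ j ℕ.+ r)) (cong (_+ 1ℚ)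
        (trans (ℕ→ℚ-+ (j ℕ.+ j) r) (cong (_+ ℕ→ℚ r) (ℕ→ℚ-+ j j))))))))
    identity : ∀ c j r → c + choose2 (j + r + 1ℚ + 1ℚ) - (c + choose2 (j + 1ℚ)) ≡ (r + 1ℚ) * (j + j + r + 1ℚ + 1ℚ) * ½
    identity = solve 3 (λ c j r → c :+ ch (j :+ r :+ con 1ℚ :+ con 1ℚ) :- (c :+ ch (j :+ con 1ℚ)) :=
      (r :+ con 1ℚ) :* (j :+ j :+ r :+ con 1ℚ :+ con 1ℚ) :* con ½) refl

  -- With m = k + r + 1, twice C(m+1,2) - C(k,2) factors as (m+1-k)(m+k), so h(k) = 0 says that this
  -- product is 2mn.
  N-zero⇒ : ∀ k r → M ≡ k ℕ.+ r → N k ≡ 0ℚ →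
    suc (suc r) ℕ.* suc (k ℕ.+ k ℕ.+ r) ≡ (suc M ℕ.+ suc M) ℕ.* n
  N-zero⇒ k r M≡ Nk≡0 = ℕ→ℚ-injective (begin
    ℕ→ℚ (suc (suc r) ℕ.* suc (k ℕ.+ k ℕ.+ r))
      ≡⟨ ℕ→ℚ-* (suc (suc r)) (suc (k ℕ.+ k ℕ.+ r)) ⟩
    ℕ→ℚ (suc (suc r)) * ℕ→ℚ (suc (k ℕ.+ k ℕ.+ r))
      ≡⟨ cong₂ _*_ (trans (ℕ→ℚ-suc (suc r)) (cong (_+ 1ℚ) (ℕ→ℚ-suc r)))
           (trans (ℕ→ℚ-suc (k ℕ.+ k ℕ.+ r)) (cong (_+ 1ℚ) (trans (ℕ→ℚ-+ (k ℕ.+ k) r) (cong (_+ ℕ→ℚ r) (ℕ→ℚ-+ k k))))) ⟩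
    (ℕ→ℚ r + 1ℚ + 1ℚ) * (ℕ→ℚ k + ℕ→ℚ k + ℕ→ℚ r + 1ℚ)
      ≡⟨ identity (ℕ→ℚ k) (ℕ→ℚ r) ν ⟩
    (ℕ→ℚ k + ℕ→ℚ r + 1ℚ + (ℕ→ℚ k + ℕ→ℚ r + 1ℚ)) * ν -
      ((ℕ→ℚ k + ℕ→ℚ r + 1ℚ) * ν - choose2 (ℕ→ℚ k + ℕ→ℚ r + 1ℚ + 1ℚ) + choose2 (ℕ→ℚ k)) * (1ℚ + 1ℚ)
      ≡⟨ cong (λ z → (z + 1ℚ + (z + 1ℚ)) * ν - ((z + 1ℚ) * ν - choose2 (z + 1ℚ + 1ℚ) + choose2 (ℕ→ℚ k)) * (1ℚ + 1ℚ)) 𝑚≡ ⟨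
    (𝑚 + 1ℚ + (𝑚 + 1ℚ)) * ν - ((𝑚 + 1ℚ) * ν - choose2 (𝑚 + 1ℚ + 1ℚ) + choose2 (ℕ→ℚ k)) * (1ℚ + 1ℚ)
      ≡⟨ cong (λ z → (𝑚 + 1ℚ + (𝑚 + 1ℚ)) * ν - z * (1ℚ + 1ℚ)) (trans (cong (_+ choose2 (ℕ→ℚ k)) (sym c-expand)) Nk≡0) ⟩
    (𝑚 + 1ℚ + (𝑚 + 1ℚ)) * ν - 0ℚ * (1ℚ + 1ℚ)
      ≡⟨ +-identityʳ _ ⟩
    (𝑚 + 1ℚ + (𝑚 + 1ℚ)) * ν
      ≡⟨ cong (_* ν) (trans (ℕ→ℚ-+ (suc M) (suc M)) (cong₂ _+_ (ℕ→ℚ-suc M) (ℕ→ℚ-suc M))) ⟨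
    ℕ→ℚ (suc M ℕ.+ suc M) * ν
      ≡⟨ ℕ→ℚ-* (suc M ℕ.+ suc M) n ⟨
    ℕ→ℚ ((suc M ℕ.+ suc M) ℕ.* n) ∎)
    where
    open ≡-Reasoning
    𝑚≡ : 𝑚 ≡ ℕ→ℚ k + ℕ→ℚ r
    𝑚≡ = trans (cong ℕ→ℚ M≡) (ℕ→ℚ-+ k r)
    identity : ∀ k r n → (r + 1ℚ + 1ℚ) * (k + k + r + 1ℚ) ≡
      (k + r + 1ℚ + (k + r + 1ℚ)) * n - ((k + r + 1ℚ) * n - choose2 (k + r + 1ℚ + 1ℚ) + choose2 k) * (1ℚ + 1ℚ)
    identity = solve 3 (λ k r n → (r :+ con 1ℚ :+ con 1ℚ) :* (k :+ k :+ r :+ con 1ℚ) :=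
      (k :+ r :+ con 1ℚ :+ (k :+ r :+ con 1ℚ)) :* n :- ((k :+ r :+ con 1ℚ) :* n :- ch (k :+ r :+ con 1ℚ :+ con 1ℚ) :+ ch k) :* (con 1ℚ :+ con 1ℚ)) refl

  -- From (r+2)(m+k) = 2mn and m + k < 2m follows n < r + 2. In `excess`, n = r + 2 + q makes 2mn
  -- too large by (r+1)(r+2) + 2mq.
  N-zero⇒n≤1+r : ∀ k r → M ≡ k ℕ.+ r → N k ≡ 0ℚ → n ≤ suc r
  N-zero⇒n≤1+r k r M≡ Nk≡0 = [ (λ n≤1+r → n≤1+r) , (λ 1+r<n → ⊥-elim (excess (ℕₚ.m≤n⇒∃[o]m+o≡n 1+r<n))) ]′ (ℕₚ.≤-<-connex n (suc r))
    where
    open ≡-Reasoning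
    L : ℕ
    L = suc (suc r) ℕ.* suc (k ℕ.+ k ℕ.+ r)
    identity : ∀ k r q → (suc (k ℕ.+ r) ℕ.+ suc (k ℕ.+ r)) ℕ.* (suc (suc r) ℕ.+ q) ≡
      suc (suc (suc r) ℕ.* suc (k ℕ.+ k ℕ.+ r) ℕ.+ (suc (r ℕ.+ r ℕ.+ r ℕ.+ r ℕ.* r) ℕ.+ (suc (k ℕ.+ r) ℕ.+ suc (k ℕ.+ r)) ℕ.* q))
    identity = ℕTactic.solve-∀
    excess : ∃[ q ] (suc (suc r) ℕ.+ q ≡ n) → ⊥
    excess (q , 2+r+q≡n) = ℕₚ.m≢1+m+n L (begin
      L
        ≡⟨ N-zero⇒ k r M≡ Nk≡0 ⟩
      (suc M ℕ.+ suc M) ℕ.* n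
        ≡⟨ cong₂ (λ z w → (suc z ℕ.+ suc z) ℕ.* w) M≡ (sym 2+r+q≡n) ⟩
      (suc (k ℕ.+ r) ℕ.+ suc (k ℕ.+ r)) ℕ.* (suc (suc r) ℕ.+ q)
        ≡⟨ identity k r q ⟩
      suc (L ℕ.+ (suc (r ℕ.+ r ℕ.+ r ℕ.+ r ℕ.* r) ℕ.+ (suc (k ℕ.+ r) ℕ.+ suc (k ℕ.+ r)) ℕ.* q)) ∎)

  -- The argument m + n − 2j of the node is k or 1 − k, and C(k,2) = C(1−k,2).
  h-reflect : ∀ j k → (suc M ℕ.+ n ≡ k ℕ.+ (j ℕ.+ j) ⊎ suc M ℕ.+ n ℕ.+ k ≡ suc (j ℕ.+ j)) → h j ≡ N k
  h-reflect j k (inj₁ e) = cong (λ z → c + choose2 z) (begin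
    𝑚 + 1ℚ + ν - (ℕ→ℚ j + ℕ→ℚ j)                         ≡⟨ cong (_- (ℕ→ℚ j + ℕ→ℚ j)) sum≡ ⟩
    ℕ→ℚ k + (ℕ→ℚ j + ℕ→ℚ j) - (ℕ→ℚ j + ℕ→ℚ j)            ≡⟨ solve 2 (λ k j → k :+ j :- j := k) refl (ℕ→ℚ k) (ℕ→ℚ j + ℕ→ℚ j) ⟩
    ℕ→ℚ k                                                ∎)
    where
    open ≡-Reasoning
    sum≡ : 𝑚 + 1ℚ + ν ≡ ℕ→ℚ k + (ℕ→ℚ j + ℕ→ℚ j)
    sum≡ = trans (cong (_+ ν) (sym (ℕ→ℚ-suc M))) (trans (sym (ℕ→ℚ-+ (suc M) n)) (trans (cong ℕ→ℚ e)
      (trans (ℕ→ℚ-+ k (j ℕ.+ j)) (cong (λ z → ℕ→ℚ k + z) (ℕ→ℚ-+ j j)))))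
  h-reflect j k (inj₂ e) = cong (λ z → c + z) (begin
    choose2 (𝑚 + 1ℚ + ν - (ℕ→ℚ j + ℕ→ℚ j))
      ≡⟨ solve 3 (λ s k j → ch (s :- j) := ch (s :+ k :- j :- k)) refl (𝑚 + 1ℚ + ν) (ℕ→ℚ k) (ℕ→ℚ j + ℕ→ℚ j) ⟩
    choose2 (𝑚 + 1ℚ + ν + ℕ→ℚ k - (ℕ→ℚ j + ℕ→ℚ j) - ℕ→ℚ k)
      ≡⟨ cong (λ z → choose2 (z - (ℕ→ℚ j + ℕ→ℚ j) - ℕ→ℚ k)) sum≡ ⟩
    choose2 (ℕ→ℚ j + ℕ→ℚ j + 1ℚ - (ℕ→ℚ j + ℕ→ℚ j) - ℕ→ℚ k)
      ≡⟨ solve 2 (λ k j → ch (j :+ con 1ℚ :- j :- k) := ch k) refl (ℕ→ℚ k) (ℕ→ℚ j + ℕ→ℚ j) ⟩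
    choose2 (ℕ→ℚ k) ∎)
    where
    open ≡-Reasoning
    sum≡ : 𝑚 + 1ℚ + ν + ℕ→ℚ k ≡ ℕ→ℚ j + ℕ→ℚ j + 1ℚ
    sum≡ = trans (cong (λ z → z + ν + ℕ→ℚ k) (sym (ℕ→ℚ-suc M))) (trans (cong (_+ ℕ→ℚ k) (sym (ℕ→ℚ-+ (suc M) n)))
      (trans (sym (ℕ→ℚ-+ (suc M ℕ.+ n) k)) (trans (cong ℕ→ℚ e) (trans (ℕ→ℚ-suc (j ℕ.+ j)) (cong (_+ 1ℚ) (ℕ→ℚ-+ j j))))))

  -- By `h-reflect` it is enough that some m+n-2j equals k+1 or -k. With M = k + 1 + r the parity of
  -- n + r decides which, and n ≤ r + 1 keeps the index within 1, ..., M.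
  N-zero⇒h-zero : ∀ k → k < M → N (suc k) ≡ 0ℚ → ∃[ j ] (j < M × h (suc j) ≡ 0ℚ)
  N-zero⇒h-zero k k<M Nk≡0 = witness (ℕₚ.m≤n⇒∃[o]m+o≡n k<M)
    where
    open ≡-Reasoning
    even₁ : ∀ k r n → suc (suc k ℕ.+ r) ℕ.+ n ℕ.+ suc k ≡ suc (suc k ℕ.+ suc k) ℕ.+ (n ℕ.+ r)
    even₁ = ℕTactic.solve-∀
    even₂ : ∀ k y → suc (suc k ℕ.+ suc k) ℕ.+ (y ℕ.+ y) ≡ suc (suc (k ℕ.+ y) ℕ.+ suc (k ℕ.+ y))
    even₂ = ℕTactic.solve-∀
    odd : ∀ k r n → suc (suc k ℕ.+ r) ℕ.+ n ≡ suc k ℕ.+ suc (n ℕ.+ r)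
    odd = ℕTactic.solve-∀
    witness : ∃[ r ] (suc k ℕ.+ r ≡ M) → ∃[ j ] (j < M × h (suc j) ≡ 0ℚ)
    witness (r , 1+k+r≡M) = split (parity (n ℕ.+ r))
      where
      n+r≤ : n ℕ.+ r ≤ suc (r ℕ.+ r)
      n+r≤ = ℕₚ.+-monoˡ-≤ r (N-zero⇒n≤1+r (suc k) r (sym 1+k+r≡M) Nk≡0)
      split : ∃[ y ] (n ℕ.+ r ≡ y ℕ.+ y ⊎ n ℕ.+ r ≡ suc (y ℕ.+ y)) → ∃[ j ] (j < M × h (suc j) ≡ 0ℚ)
      -- The index k+1+y gives the argument -k; 2y ≤ 2r+1 yields y ≤ r, so the index is at most M.
      split (y , inj₁ n+r≡2y) = k ℕ.+ y ,
        subst (k ℕ.+ y <_) 1+k+r≡M (s≤s (ℕₚ.+-monoʳ-≤ k (y+y≤1+r+r⇒y≤r y r (subst (_≤ suc (r ℕ.+ r)) n+r≡2y n+r≤)))) ,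
        trans (h-reflect (suc (k ℕ.+ y)) (suc k) (inj₂ (begin
          suc M ℕ.+ n ℕ.+ suc k                   ≡⟨ cong (λ z → suc z ℕ.+ n ℕ.+ suc k) 1+k+r≡M ⟨
          suc (suc k ℕ.+ r) ℕ.+ n ℕ.+ suc k       ≡⟨ even₁ k r n ⟩
          suc (suc k ℕ.+ suc k) ℕ.+ (n ℕ.+ r)     ≡⟨ cong (suc (suc k ℕ.+ suc k) ℕ.+_) n+r≡2y ⟩
          suc (suc k ℕ.+ suc k) ℕ.+ (y ℕ.+ y)     ≡⟨ even₂ k y ⟩
          suc (suc (k ℕ.+ y) ℕ.+ suc (k ℕ.+ y))   ∎))) Nk≡0
      -- The index y+1 gives the argument k+1, and again y ≤ r.
      split (y , inj₂ n+r≡1+2y) = y ,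
        subst (y <_) 1+k+r≡M (s≤s (ℕₚ.≤-trans
          (y+y≤1+r+r⇒y≤r y r (ℕₚ.≤-trans (ℕₚ.n≤1+n _) (subst (_≤ suc (r ℕ.+ r)) n+r≡1+2y n+r≤))) (ℕₚ.m≤n+m r k))) ,
        trans (h-reflect (suc y) (suc k) (inj₁ (begin
          suc M ℕ.+ n                             ≡⟨ cong (λ z → suc z ℕ.+ n) 1+k+r≡M ⟨
          suc (suc k ℕ.+ r) ℕ.+ n                 ≡⟨ odd k r n ⟩
          suc k ℕ.+ suc (n ℕ.+ r)                 ≡⟨ cong (λ z → suc k ℕ.+ suc z) n+r≡1+2y ⟩
          suc k ℕ.+ suc (suc (y ℕ.+ y))           ≡⟨ cong (λ z → suc k ℕ.+ suc z) (ℕₚ.+-suc y y) ⟨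
          suc k ℕ.+ (suc y ℕ.+ suc y)             ∎))) Nk≡0

  -- Abel summation of the left-hand side.

  open Saalschütz c

  k : ℕ → ℚ
  k = coef 𝑚 ν

  -- `τ` is the summand `t` with its denominators cleared: if h(m+n-2j) ≠ 0 for 1 ≤ j ≤ i, it is the
  -- product of -(m-j)C(n-2j,2)/j over these j.
  f t τ : ℕ → ℚ
  f = lhsFactor (suc M) n
  t i = prod i f
  τ i = t i * prod i h

  f-h : ∀ i → h (suc i) ≢ 0ℚ → f (suc i) * h (suc i) ≡ - a (suc i) * recip i
  f-h i h≢0 = begin
    f (suc i) * h (suc i)
      ≡⟨ *-identityʳ _ ⟨
    f (suc i) * h (suc i) * 1ℚ
      ≡⟨ cong (f (suc i) * h (suc i) *_) (trans (cong (_* recip i) (ℕ→ℚ-suc i)) (recip-inverse i)) ⟨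
    f (suc i) * h (suc i) * (ℕ→ℚ (suc i) * recip i)
      ≡⟨ solve 4 (λ f h j u → f :* h :* (j :* u) := f :* (j :* h) :* u) refl (f (suc i)) (h (suc i)) (ℕ→ℚ (suc i)) (recip i) ⟩
    f (suc i) * (ℕ→ℚ (suc i) * h (suc i)) * recip i
      ≡⟨ cong (λ z → f (suc i) * z * recip i) (D-h (suc i)) ⟨
    f (suc i) * D (suc M) n (suc i) * recip i
      ≡⟨ cong (_* recip i) (÷₀-* _ D≢0) ⟩
    - ((ℕ→ℚ (suc M) - ℕ→ℚ (suc i)) * choose2 (ν - ℕ→ℚ (2 ℕ.* suc i))) * recip i
      ≡⟨ cong (λ z → - z * recip i) (a-def (suc i)) ⟩
    - a (suc i) * recip i ∎
    where
    open ≡-Reasoning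
    D≢0 : D (suc M) n (suc i) ≢ 0ℚ
    D≢0 e = *-≢0 (ℕ→ℚ-suc≢0 i) h≢0 (trans (sym (D-h (suc i))) e)

  τ-suc : ∀ i → h (suc i) ≢ 0ℚ → τ (suc i) ≡ τ i * (- a (suc i) * recip i)
  τ-suc i h≢0 = trans
    (solve 4 (λ t f p h → t :* f :* (p :* h) := t :* p :* (f :* h)) refl (t i) (f (suc i)) (prod i h) (h (suc i)))
    (cong (τ i *_) (f-h i h≢0))

  -- Both are products of the same binomials and linear factors; `k (suc i)` has C(n,2), M - i and a
  -- sign in addition, and (i+1)! in place of i!.
  coef-τ : ∀ i → (∀ j → j < i → h (suc j) ≢ 0ℚ) →
    k (suc i) ≡ - (τ i * (choose2 ν * (𝑚 - ℕ→ℚ i) * recip i))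
  coef-τ zero _ = identity 𝑚 ν (recip 0)
    where
    identity : ∀ m n u → 1ℚ * (- ((m - 0ℚ) * choose2 (n - (0ℚ + 0ℚ)))) * u ≡ - (1ℚ * 1ℚ * (choose2 n * (m - 0ℚ) * u))
    identity = solve 3 (λ m n u → con 1ℚ :* (:- ((m :- con 0ℚ) :* ch (n :- (con 0ℚ :+ con 0ℚ)))) :* u :=
      :- (con 1ℚ :* con 1ℚ :* (ch n :* (m :- con 0ℚ) :* u))) refl
  coef-τ (suc i) h≢0 = begin
    k (suc i) * (- ((𝑚 - ℕ→ℚ (suc i)) * choose2 x)) * recip (suc i)
      ≡⟨ cong (λ z → z * (- ((𝑚 - ℕ→ℚ (suc i)) * choose2 x)) * recip (suc i)) (coef-τ i (λ j j<i → h≢0 j (ℕₚ.m<n⇒m<1+n j<i))) ⟩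
    - (τ i * (choose2 ν * (𝑚 - ℕ→ℚ i) * recip i)) * (- ((𝑚 - ℕ→ℚ (suc i)) * choose2 x)) * recip (suc i)
      ≡⟨ identity 𝑚 (ℕ→ℚ i) (τ i) (choose2 ν) (choose2 x) (recip i) (recip (suc i)) (ℕ→ℚ-suc i) ⟩
    - (τ i * (- a (suc i) * recip i) * (choose2 ν * (𝑚 - ℕ→ℚ (suc i)) * recip (suc i)))
      ≡⟨ cong (λ z → - (z * (choose2 ν * (𝑚 - ℕ→ℚ (suc i)) * recip (suc i)))) (τ-suc i (h≢0 i ℕₚ.≤-refl)) ⟨
    - (τ (suc i) * (choose2 ν * (𝑚 - ℕ→ℚ (suc i)) * recip (suc i))) ∎
    where
    open ≡-Reasoning
    x : ℚ
    x = ν - (ℕ→ℚ (suc i) + ℕ→ℚ (suc i))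
    identity : ∀ m i s b d u w {i′} → i′ ≡ i + 1ℚ →
      - (s * (b * (m - i) * u)) * (- ((m - i′) * d)) * w ≡ - (s * (- ((m + 1ℚ - i′) * d) * u) * (b * (m - i′) * w))
    identity m i s b d u w refl = solve 7 (λ m i s b d u w →
      :- (s :* (b :* (m :- i) :* u)) :* (:- ((m :- (i :+ con 1ℚ)) :* d)) :* w :=
      :- (s :* (:- ((m :+ con 1ℚ :- (i :+ con 1ℚ)) :* d) :* u) :* (b :* (m :- (i :+ con 1ℚ)) :* w))) refl m i s b d u w

  h-recip : ∀ i → h (suc i) ≡ ((𝑚 + 1ℚ) * choose2 ν - a (suc i)) * recip i
  h-recip i = begin
    h (suc i)                                      ≡⟨ *-identityˡ (h (suc i)) ⟨
    1ℚ * h (suc i)                                 ≡⟨ cong (_* h (suc i)) (trans (cong (_* recip i) (ℕ→ℚ-suc i)) (recip-inverse i)) ⟨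
    ℕ→ℚ (suc i) * recip i * h (suc i)              ≡⟨ solve 3 (λ j u h → j :* u :* h := j :* h :* u) refl (ℕ→ℚ (suc i)) (recip i) (h (suc i)) ⟩
    ℕ→ℚ (suc i) * h (suc i) * recip i              ≡⟨ cong (_* recip i) (D-factor (suc i)) ⟨
    ((𝑚 + 1ℚ) * choose2 ν - a (suc i)) * recip i   ∎
    where open ≡-Reasoning

  -- Abel summation with an explicit boundary term, which is zero at the index where the sum is cut
  -- off.
  S-partial : ∀ i → (∀ j → j < i → h (suc j) ≢ 0ℚ) →
    (𝑚 + 1ℚ) * S 𝑚 ν i ≡ sum0 i t * prod i h + (𝑚 - ℕ→ℚ i) * τ i
  S-partial zero _ = solve 1 (λ m → (m :+ con 1ℚ) :* con 1ℚ := con 1ℚ :* con 1ℚ :+ (m :- con 0ℚ) :* (con 1ℚ :* con 1ℚ)) refl 𝑚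
  S-partial (suc i) h≢0 = begin
    (𝑚 + 1ℚ) * (S 𝑚 ν i * h′ + k (suc i))
      ≡⟨ solve 4 (λ m s h k → m :* (s :* h :+ k) := m :* s :* h :+ m :* k) refl (𝑚 + 1ℚ) (S 𝑚 ν i) h′ (k (suc i)) ⟩
    (𝑚 + 1ℚ) * S 𝑚 ν i * h′ + (𝑚 + 1ℚ) * k (suc i)
      ≡⟨ cong₂ (λ z w → z * h′ + (𝑚 + 1ℚ) * w) (S-partial i h≢0′) (coef-τ i h≢0′) ⟩
    (sum0 i t * p + (𝑚 - ℕ→ℚ i) * τ i) * h′ + (𝑚 + 1ℚ) * (- (τ i * (choose2 ν * (𝑚 - ℕ→ℚ i) * u)))
      ≡⟨ solve 8 (λ m i q p s h b u → (q :* p :+ (m :- i) :* s) :* h :+ (m :+ con 1ℚ) :* (:- (s :* (b :* (m :- i) :* u))) :=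
                   q :* p :* h :+ (m :- i) :* s :* (h :- (m :+ con 1ℚ) :* b :* u)) refl 𝑚 (ℕ→ℚ i) (sum0 i t) p (τ i) h′ (choose2 ν) u ⟩
    sum0 i t * p * h′ + (𝑚 - ℕ→ℚ i) * τ i * (h′ - (𝑚 + 1ℚ) * choose2 ν * u)
      ≡⟨ cong (λ z → sum0 i t * p * h′ + (𝑚 - ℕ→ℚ i) * τ i * (z - (𝑚 + 1ℚ) * choose2 ν * u)) (h-recip i) ⟩
    -- The two m·C(n,2) terms cancel and leave M - i copies of `τ (suc i)`: one is the new summand,
    -- the others form the new boundary term.
    sum0 i t * p * h′ + (𝑚 - ℕ→ℚ i) * τ i * (((𝑚 + 1ℚ) * choose2 ν - a (suc i)) * u - (𝑚 + 1ℚ) * choose2 ν * u)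
      ≡⟨ solve 7 (λ x m i s y b u → x :+ (m :- i) :* s :* ((y :- b) :* u :- y :* u) :=
                   x :+ s :* (:- b :* u) :+ (m :- (i :+ con 1ℚ)) :* (s :* (:- b :* u))) refl
           (sum0 i t * p * h′) 𝑚 (ℕ→ℚ i) (τ i) ((𝑚 + 1ℚ) * choose2 ν) (a (suc i)) u ⟩
    sum0 i t * p * h′ + τ i * (- a (suc i) * u) + (𝑚 - (ℕ→ℚ i + 1ℚ)) * (τ i * (- a (suc i) * u))
      ≡⟨ cong₂ (λ z w → sum0 i t * p * h′ + z + (𝑚 - w) * z) (sym (τ-suc i (h≢0 i ℕₚ.≤-refl))) (sym (ℕ→ℚ-suc i)) ⟩
    sum0 i t * p * h′ + τ (suc i) + (𝑚 - ℕ→ℚ (suc i)) * τ (suc i)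
      ≡⟨ cong (_+ (𝑚 - ℕ→ℚ (suc i)) * τ (suc i))
           (solve 4 (λ q p h t → q :* p :* h :+ t :* (p :* h) := (q :+ t) :* (p :* h)) refl (sum0 i t) p h′ (t (suc i))) ⟩
    sum0 (suc i) t * prod (suc i) h + (𝑚 - ℕ→ℚ (suc i)) * τ (suc i) ∎
    where
    open ≡-Reasoning
    p u h′ : ℚ
    p = prod i h
    u = recip i
    h′ = h (suc i)
    h≢0′ : ∀ j → j < i → h (suc j) ≢ 0ℚ
    h≢0′ j j<i = h≢0 j (ℕₚ.m<n⇒m<1+n j<i)

  -- Cancelling the zero factors.

  -- `K` is where the cleared sum stops gaining terms: ⌊n/2⌋ if that is at most M, and M otherwise.
  module Truncation (K : ℕ) (K≤M : K ≤ M) (h≢0 : ∀ j → j < K → h (suc j) ≢ 0ℚ)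
    (k-vanishes : k (suc K) ≡ 0ℚ) (τ-vanishes : (𝑚 - ℕ→ℚ K) * τ K ≡ 0ℚ) where

    L : ℚ
    L = sum0 K t

    ign-h ign-N : ℕ → ℚ
    ign-h j = ign (h j)
    ign-N j = ign (N j)

    k-tail : ∀ d → k (suc (d ℕ.+ K)) ≡ 0ℚ
    k-tail zero    = k-vanishes
    k-tail (suc d) = trans (cong (λ z → z * x * recip (suc (d ℕ.+ K))) (k-tail d))
      (trans (cong (_* recip (suc (d ℕ.+ K))) (*-zeroˡ x)) (*-zeroˡ (recip (suc (d ℕ.+ K)))))
      where
      x : ℚ
      x = - ((𝑚 - ℕ→ℚ (suc (d ℕ.+ K))) * choose2 (ν - (ℕ→ℚ (suc (d ℕ.+ K)) + ℕ→ℚ (suc (d ℕ.+ K)))))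

    -- At K no node has vanished yet, and `none` leaves the derivative free. Beyond K the
    -- coefficients are zero, so each Horner step is multiplication by (h, 1) over the dual numbers.
    S-ZeroFactors : ∀ d → ZeroFactors h (d ℕ.+ K)
      ((𝑚 + 1ℚ) * S 𝑚 ν (d ℕ.+ K)) ((𝑚 + 1ℚ) * S′ 𝑚 ν (d ℕ.+ K)) (L * prod (d ℕ.+ K) ign-h)
    S-ZeroFactors zero = none h≢0 (begin
      (𝑚 + 1ℚ) * S 𝑚 ν K                      ≡⟨ S-partial K h≢0 ⟩
      L * prod K h + (𝑚 - ℕ→ℚ K) * τ K        ≡⟨ cong (λ z → L * prod K h + z) τ-vanishes ⟩
      L * prod K h + 0ℚ                       ≡⟨ +-identityʳ _ ⟩
      L * prod K h                            ≡⟨ cong (L *_) (prod-cong K (λ j j<K → sym (ign-id (h≢0 j j<K)))) ⟩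
      L * prod K ign-h                        ∎)
      where open ≡-Reasoning
    S-ZeroFactors (suc d) = subst₂ (λ x x′ → ZeroFactors h (suc i) x x′ (L * prod (suc i) ign-h)) x≡ x′≡
      (subst (ZeroFactors h (suc i) _ _) (*-assoc L (prod i ign-h) (ign-h (suc i))) (ZeroFactors-suc (S-ZeroFactors d)))
      where
      i : ℕ
      i = d ℕ.+ K
      x≡ : (𝑚 + 1ℚ) * S 𝑚 ν i * h (suc i) ≡ (𝑚 + 1ℚ) * S 𝑚 ν (suc i)
      x≡ = trans (solve 3 (λ m s h → m :* s :* h := m :* (s :* h :+ con 0ℚ)) refl (𝑚 + 1ℚ) (S 𝑚 ν i) (h (suc i)))
                 (cong (λ z → (𝑚 + 1ℚ) * (S 𝑚 ν i * h (suc i) + z)) (sym (k-tail d)))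
      x′≡ : (𝑚 + 1ℚ) * S′ 𝑚 ν i * h (suc i) + (𝑚 + 1ℚ) * S 𝑚 ν i ≡ (𝑚 + 1ℚ) * S′ 𝑚 ν (suc i)
      x′≡ = solve 4 (λ m s′ s h → m :* s′ :* h :+ m :* s := m :* (s′ :* h :+ s)) refl (𝑚 + 1ℚ) (S′ 𝑚 ν i) (S 𝑚 ν i) (h (suc i))

    𝑚+1≢0 : 𝑚 + 1ℚ ≢ 0ℚ
    𝑚+1≢0 e = ℕ→ℚ-suc≢0 M (trans (ℕ→ℚ-suc M) e)

    nonzero : ∀ {x} → x ≡ prod M ign-N → (𝑚 + 1ℚ) * x ≢ 0ℚ
    nonzero e = *-≢0 𝑚+1≢0 (λ x≡0 → prod-≢0 M (λ j → ign-≢0 (N j)) (trans (sym e) x≡0))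

    -- If no numerator is zero, then S ≠ 0, so no node is zero and the values of S are compared. If
    -- one is zero, `N-zero⇒h-zero` gives a zero node, S′ ≠ 0 rules out a second, and the values of
    -- S′ are compared.
    compare : ZeroFactors N M (S 𝑚 ν M) (S′ 𝑚 ν M) (prod M ign-N) →
      ZeroFactors h M ((𝑚 + 1ℚ) * S 𝑚 ν M) ((𝑚 + 1ℚ) * S′ 𝑚 ν M) (L * prod M ign-h) →
      L * prod M ign-h ≡ (𝑚 + 1ℚ) * prod M ign-N
    compare (none _ X≡)          (none _ Y≡)                = trans (sym Y≡) (cong ((𝑚 + 1ℚ) *_) X≡)
    compare (none _ X≡)          (one _ _ _ Y≡0 _)          = ⊥-elim (nonzero X≡ Y≡0)
    compare (none _ X≡)          (many _ _ _ _ _ _ Y≡0 _)   = ⊥-elim (nonzero X≡ Y≡0)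
    compare (one j j<M e _ X′≡)  (none ≢0 _)                = let i , i<M , hi≡0 = N-zero⇒h-zero j j<M e in ⊥-elim (≢0 i i<M hi≡0)
    compare (one _ _ _ _ X′≡)    (one _ _ _ _ Y′≡)          = trans (sym Y′≡) (cong ((𝑚 + 1ℚ) *_) X′≡)
    compare (one _ _ _ _ X′≡)    (many _ _ _ _ _ _ _ Y′≡0)  = ⊥-elim (nonzero X′≡ Y′≡0)
    compare (many i j i<j _ e₁ e₂ _ _) _                    = ⊥-elim (N-zero-unique i j i<j e₁ e₂)

    sum-ign : L * prod M ign-h ≡ (𝑚 + 1ℚ) * prod M ign-N
    sum-ign = compare
      (subst₂ (λ x x′ → ZeroFactors N M x x′ (prod M ign-N)) (sym (S-total M ν)) (sym (S′-total M ν)) (prod-ZeroFactors N M))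
      (subst (λ i → ZeroFactors h i ((𝑚 + 1ℚ) * S 𝑚 ν i) ((𝑚 + 1ℚ) * S′ 𝑚 ν i) (L * prod i ign-h))
             (ℕₚ.m∸n+n≡m K≤M) (S-ZeroFactors (M ℕ.∸ K)))

    sum-RHS : L ≡ RHS (suc M) n
    sum-RHS = *-cancelʳ-≢0 (prod M ign-h) (prod-≢0 M (λ j → ign-≢0 (h j))) (begin
      L * prod M ign-h
        ≡⟨ sum-ign ⟩
      (𝑚 + 1ℚ) * prod M ign-N
        ≡⟨ cong₂ _*_ (ℕ→ℚ-suc M) (prod-÷₀ M ign-N (λ j → ign-≢0 (h j))) ⟨
      ℕ→ℚ (suc M) * (prod M (λ j → ign-N j ÷₀ ign-h j) * prod M ign-h)
        ≡⟨ *-assoc (ℕ→ℚ (suc M)) _ _ ⟨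
      ℕ→ℚ (suc M) * prod M (λ j → ign-N j ÷₀ ign-h j) * prod M ign-h
        ≡⟨ cong (λ z → ℕ→ℚ (suc M) * z * prod M ign-h) (prod-cong M (λ j _ → cong (λ z → ign-N (suc j) ÷₀ ign z) (sym (dj-h j)))) ⟩
      RHS (suc M) n * prod M ign-h ∎)
      where open ≡-Reasoning

  -- The end of the summation range and the two cases for ⌊n/2⌋.

  -- The denominator is unrestricted because `÷₀` returns 0 on a zero divisor.
  f-zero : ∀ i → a i ≡ 0ℚ → f i ≡ 0ℚ
  f-zero i a≡0 = trans (cong (λ z → (- z) ÷₀ D (suc M) n i) (trans (a-def i) a≡0)) (0÷₀ (D (suc M) n i))

  t-zero : ∀ i → a (suc i) ≡ 0ℚ → t (suc i) ≡ 0ℚ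
  t-zero i a≡0 = trans (cong (t i *_) (f-zero (suc i) a≡0)) (*-zeroʳ (t i))

  -- 2(j+1) ≤ n, so `h-≢0` applies; hence all divisions on the left-hand side are genuine.
  h≢0-below-n/2 : ∀ j → j < n ℕ./ 2 → h (suc j) ≢ 0ℚ
  h≢0-below-n/2 j j<n/2 with ℕₚ.m≤n⇒∃[o]m+o≡n (ℕₚ.≤-trans (ℕₚ.*-monoˡ-≤ 2 j<n/2) (ℕ.m/n*n≤m n 2))
  ... | r , e = h-≢0 j r (trans (sym e) (cong (ℕ._+ r) (double (suc j))))
    where
    double : ∀ x → x ℕ.* 2 ≡ x ℕ.+ x
    double = ℕTactic.solve-∀

  -- n - 2⌊n/2⌋ is 0 or 1, and both are roots of C(x,2).
  choose2-n/2 : choose2 (ν - (ℕ→ℚ (n ℕ./ 2) + ℕ→ℚ (n ℕ./ 2))) ≡ 0ℚ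
  choose2-n/2 = trans (cong choose2 (begin
    ν - (h₂ + h₂)                                  ≡⟨ cong (λ z → ℕ→ℚ z - (h₂ + h₂)) (ℕ.m≡m%n+[m/n]*n n 2) ⟩
    ℕ→ℚ (n ℕ.% 2 ℕ.+ n ℕ./ 2 ℕ.* 2) - (h₂ + h₂)    ≡⟨ cong (_- (h₂ + h₂)) (ℕ→ℚ-+ (n ℕ.% 2) (n ℕ./ 2 ℕ.* 2)) ⟩
    r + ℕ→ℚ (n ℕ./ 2 ℕ.* 2) - (h₂ + h₂)            ≡⟨ cong (λ z → r + z - (h₂ + h₂)) (ℕ→ℚ-* (n ℕ./ 2) 2) ⟩
    r + h₂ * ℕ→ℚ 2 - (h₂ + h₂)                     ≡⟨ solve 2 (λ r h → r :+ h :* con (ℕ→ℚ 2) :- (h :+ h) := r) refl r h₂ ⟩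
    r                                              ∎)) (remainder (n ℕ.% 2) (ℕ.m%n<n n 2))
    where
    open ≡-Reasoning
    h₂ r : ℚ
    h₂ = ℕ→ℚ (n ℕ./ 2)
    r = ℕ→ℚ (n ℕ.% 2)
    remainder : ∀ x → x < 2 → choose2 (ℕ→ℚ x) ≡ 0ℚ
    remainder zero          _ = refl
    remainder (suc zero)    _ = refl
    remainder (suc (suc _)) (s≤s (s≤s ()))

theorem2 : (m n : ℕ) → 1 ≤ m → 2 ≤ n → LHS m n ≡ RHS m n
theorem2 (suc M) n _ 2≤n = [ n/2-small , n/2-large ]′ (ℕₚ.≤-<-connex (n ℕ./ 2) M)
  where
  open Factors M n
  K : ℕ
  K = n ℕ./ 2

  -- C(n-2K,2) = 0 kills both the coefficient at K + 1 and the boundary term.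
  n/2-small : K ≤ M → LHS (suc M) n ≡ RHS (suc M) n
  n/2-small K≤M = trans
    (cong (λ i → sum0 i t) (ℕₚ.m≥n⇒m⊓n≡n (ℕₚ.m≤n⇒m≤1+n K≤M)))
    (Truncation.sum-RHS K K≤M h≢0-below-n/2
      (trans (cong (λ z → coef 𝑚 ν K * (- ((𝑚 - ℕ→ℚ K) * z)) * recip K) choose2-n/2)
        (solve 3 (λ x y u → x :* (:- (y :* con 0ℚ)) :* u := con 0ℚ) refl (coef 𝑚 ν K) (𝑚 - ℕ→ℚ K) (recip K)))
      -- n ≥ 2 gives K ≥ 1, so the factor with index K does occur in `t K`.
      (trans (cong (λ z → (𝑚 - ℕ→ℚ K) * (z * prod K h)) (t≡0 K (ℕ.m≥n⇒m/n>0 2≤n) choose2-n/2))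
        (solve 2 (λ x y → x :* (con 0ℚ :* y) := con 0ℚ) refl (𝑚 - ℕ→ℚ K) (prod K h))))
    where
    t≡0 : ∀ i → 0 < i → choose2 (ν - (ℕ→ℚ i + ℕ→ℚ i)) ≡ 0ℚ → t i ≡ 0ℚ
    t≡0 (suc i) _ e = t-zero i (trans (cong ((𝑚 + 1ℚ - ℕ→ℚ (suc i)) *_) e) (*-zeroʳ (𝑚 + 1ℚ - ℕ→ℚ (suc i))))

  -- The range ends at m = M + 1, but the last summand contains m - m = 0, so the sum is cut at M,
  -- where the boundary factor is M - M.
  n/2-large : M < K → LHS (suc M) n ≡ RHS (suc M) n
  n/2-large M<K = trans
    (trans (cong (λ i → sum0 i t) (ℕₚ.m≤n⇒m⊓n≡m M<K))
      (trans (cong (λ z → sum0 M t + z) (t-zero M a≡0)) (+-identityʳ (sum0 M t))))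
    (Truncation.sum-RHS M ℕₚ.≤-refl (λ j j<M → h≢0-below-n/2 j (ℕₚ.<-trans j<M M<K))
      (Saalschütz.coef-vanishes c M ν) (trans (cong (_* τ M) (+-inverseʳ 𝑚)) (*-zeroˡ (τ M))))
    where
    x : ℚ
    x = ν - (ℕ→ℚ (suc M) + ℕ→ℚ (suc M))
    a≡0 : a (suc M) ≡ 0ℚ
    a≡0 = trans (cong (λ z → (z - ℕ→ℚ (suc M)) * choose2 x) (sym (ℕ→ℚ-suc M)))
      (trans (cong (_* choose2 x) (+-inverseʳ (ℕ→ℚ (suc M)))) (*-zeroˡ (choose2 x)))
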